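{- Let $\mathbb{V}$ be a vector space of dimension $n$ over a field $\mathbb{F}$ with $q$ elements, and let $\Gamma(\mathbb{V})$ be its non-zero component graph with respect to a basis $\{b_1,\ldots,b_n\}$. If $q=2$ and $n>3$, then the exchange property does not hold for locating-dominating sets in $\Gamma(\mathbb{V})$.
   Context: Non-zero component graph: given a finite-dimensional vector space $\mathbb{V}$ over $\mathbb{F}$ with basis $\{b_1,\ldots,b_n\}$, $\Gamma(\mathbb{V})$ is the simple graph whose vertices are the non-zero vectors of $\mathbb{V}$; two distinct vertices are adjacent if and only if there is some $b_i$ that has non-zero coefficient in the unique linear combinations (with respect to the basis) of both. For a graph $\Gamma$ and a vertex $u$, $N(u)$ is the set of vertices adjacent to $u$. A set $L_D\subseteq V(\Gamma)$ is a locating-dominating set for $\Gamma$ if for every two distinct vertices $u,v\in V(\Gamma)\setminus L_D$ we have $\emptyset\ne N(u)\cap L_D\ne N(v)\cap L_D\ne\emptyset$ (i.e. both intersections are non-empty and they are different from each other). A locating-dominating set is minimal if it is minimal with respect to inclusion among locating-dominating sets. Exchange property: locating-dominating sets have the exchange property in $\Gamma$ if whenever $L_{D_1}$ and $L_{D_2}$ are minimal locating-dominating sets for $\Gamma$ and $u_1\in L_{D_1}$, there exists $u_2\in L_{D_2}$ such that $(L_{D_2}\setminus\{u_2\})\cup\{u_1\}$ is also a minimal locating-dominating set. -}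

module Defs where

open import Algebra.Bundles using (CommutativeRing)
open import Algebra.Module.Bundles using (Module)
import Algebra.Properties.CommutativeMonoid.Sum as Sum
open import Data.Bool.Base using (Bool; T)
open import Data.Fin.Base using (Fin)
open import Data.Nat.Base using (ℕ)
open import Data.Product.Base using (Σ; ∃; ∃-syntax; _×_; _,_; proj₁; swap)
open import Data.Vec.Functional using (Vector)
open import Function.Base using (_∘_)
open import Function.Bundles using (Bijection; Func)
open import Level using (Level; _⊔_) renaming (suc to lsuc)
open import Relation.Binary.Bundles using (Setoid)
open import Relation.Binary.Core using (Rel)
import Relation.Binary.Construct.On as On
open import Relation.Binary.Definitions using (Irreflexive; Symmetric; _Respects₂_)
import Relation.Binary.PropositionalEquality.Properties as ≡
open import Relation.Nullary.Negation using (¬_)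
open import Relation.Unary using (Pred; _∈_; _∉_; _⊆_; _≐_; _∩_; _∪_; _∖_; Satisfiable)

record Field c ℓ : Set (lsuc (c ⊔ ℓ)) where
  field
    commutativeRing : CommutativeRing c ℓ
  open CommutativeRing commutativeRing public
  field
    1≉0     : ¬ 1# ≈ 0#
    inverse : ∀ x → ¬ x ≈ 0# → ∃[ y ] x * y ≈ 1#

HasCardinality : ∀ {c ℓ} → Setoid c ℓ → ℕ → Set (c ⊔ ℓ)
HasCardinality S q = Bijection S (≡.setoid (Fin q))

VectorSpace : ∀ {c ℓ} → Field c ℓ → (m ℓm : Level) → Set (c ⊔ ℓ ⊔ lsuc (m ⊔ ℓm))
VectorSpace F m ℓm = Module (Field.commutativeRing F) m ℓm

module _ {c ℓ m ℓm} (F : Field c ℓ) (V : VectorSpace F m ℓm) where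
  open Field F using (Carrier; _≈_; 0#)
  open Module V using (Carrierᴹ; _≈ᴹ_; 0ᴹ; _*ₗ_; +ᴹ-commutativeMonoid)
  open Sum +ᴹ-commutativeMonoid using (sum)

  linearCombination : ∀ {n} → Vector Carrierᴹ n → Vector Carrier n → Carrierᴹ
  linearCombination b a = sum (λ i → a i *ₗ b i)

  record Basis (n : ℕ) : Set (c ⊔ ℓ ⊔ m ⊔ ℓm) where
    field
      vector      : Vector Carrierᴹ n
      independent : ∀ a → linearCombination vector a ≈ᴹ 0ᴹ → ∀ i → a i ≈ 0#
      spanning    : ∀ v → ∃[ a ] v ≈ᴹ linearCombination vector a

-- Vertices are considered up to the setoid equality _≈_, so that "distinct"
-- means ¬ u ≈ v.
record SimpleGraph v ℓ e : Set (lsuc (v ⊔ ℓ ⊔ e)) where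
  field
    vertices    : Setoid v ℓ
  open Setoid vertices public using (_≈_) renaming (Carrier to Vertex)
  field
    Adjacent    : Rel Vertex e
    respects    : Adjacent Respects₂ _≈_
    symmetric   : Symmetric Adjacent
    irreflexive : Irreflexive _≈_ Adjacent

module _ {c ℓ m ℓm} (F : Field c ℓ) (V : VectorSpace F m ℓm) {n : ℕ} (b : Basis F V n) where
  open Field F using (_≈_; 0#)
  open Module V using (Carrierᴹ; _≈ᴹ_; 0ᴹ; ≈ᴹ-setoid; ≈ᴹ-trans; ≈ᴹ-sym)

  -- The linear combination of a vector is unique by independence, so the
  -- existential over a ranges over a single coefficient family.
  HasNonZeroCoefficient : Carrierᴹ → Fin n → Set (c ⊔ ℓ ⊔ ℓm)
  HasNonZeroCoefficient v i =
    ∃[ a ] v ≈ᴹ linearCombination F V (Basis.vector b) a × ¬ a i ≈ 0#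

  nonZeroComponentGraph : SimpleGraph (m ⊔ ℓm) ℓm (c ⊔ ℓ ⊔ ℓm)
  nonZeroComponentGraph = record
    { vertices    = On.setoid {B = Σ Carrierᴹ (λ v → ¬ v ≈ᴹ 0ᴹ)} ≈ᴹ-setoid proj₁
    ; Adjacent    = λ (u , _) (v , _) →
                      ¬ u ≈ᴹ v × ∃[ i ] HasNonZeroCoefficient u i × HasNonZeroCoefficient v i
    ; respects    =
        (λ v≈w (u≉v , i , p , q) →
          (λ u≈w → u≉v (≈ᴹ-trans u≈w (≈ᴹ-sym v≈w))) , i , p , resp v≈w q)
      , (λ v≈w (v≉u , i , p , q) →
          (λ w≈u → v≉u (≈ᴹ-trans v≈w w≈u)) , i , resp v≈w p , q)
    ; symmetric   = λ (u≉v , i , pq) → u≉v ∘ ≈ᴹ-sym , i , swap pq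
    ; irreflexive = λ u≈v (u≉v , _) → u≉v u≈v
    }
    where
    resp : ∀ {u v i} → u ≈ᴹ v → HasNonZeroCoefficient u i → HasNonZeroCoefficient v i
    resp u≈v (a , u≈a , a≉0) = a , ≈ᴹ-trans (≈ᴹ-sym u≈v) u≈a , a≉0

module LocatingDomination {v ℓ e} (Γ : SimpleGraph v ℓ e) where
  open SimpleGraph Γ

  N : Vertex → Pred Vertex e
  N u w = Adjacent u w

  -- Sets of vertices are given by characteristic functions respecting _≈_, as
  -- classically every subset has one.
  VertexSet : Set (v ⊔ ℓ)
  VertexSet = Func vertices (≡.setoid Bool)

  ⟦_⟧ : VertexSet → Pred Vertex _
  ⟦ L ⟧ u = T (Func.to L u)

  ｛_｝ : Vertex → Pred Vertex ℓ
  ｛ u ｝ w = w ≈ u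

  IsLocatingDominating : ∀ {p} → Pred Vertex p → Set (v ⊔ ℓ ⊔ e ⊔ p)
  IsLocatingDominating L = ∀ u w → u ∉ L → w ∉ L → ¬ u ≈ w →
    Satisfiable (N u ∩ L) × ¬ (N u ∩ L ≐ N w ∩ L) × Satisfiable (N w ∩ L)

  IsMinimalLocatingDominating : ∀ {p} → Pred Vertex p → Set (v ⊔ ℓ ⊔ e ⊔ p)
  IsMinimalLocatingDominating L = IsLocatingDominating L ×
    (∀ (K : VertexSet) → IsLocatingDominating ⟦ K ⟧ → ⟦ K ⟧ ⊆ L → L ⊆ ⟦ K ⟧)

  -- The exchanged set is a predicate rather than a VertexSet because _≈_ is
  -- not assumed decidable for a general graph.
  ExchangeProperty : Set (v ⊔ ℓ ⊔ e)
  ExchangeProperty = ∀ (L₁ L₂ : VertexSet) →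
    IsMinimalLocatingDominating ⟦ L₁ ⟧ → IsMinimalLocatingDominating ⟦ L₂ ⟧ →
    ∀ u₁ → u₁ ∈ ⟦ L₁ ⟧ →
    ∃[ u₂ ] u₂ ∈ ⟦ L₂ ⟧ × IsMinimalLocatingDominating ((⟦ L₂ ⟧ ∖ ｛ u₂ ｝) ∪ ｛ u₁ ｝)

{-# OPTIONS --safe #-}

-- Over the field with two elements a vertex is the same thing as its support, a
-- non-empty subset of Fin n, and two vertices are adjacent when their supports
-- meet. The singletons form a minimal locating-dominating set. When n > 3, no
-- singleton ⁅ i ⁆ can be exchanged for a non-singleton u: if i ∉ u then ⁅ i ⁆ is
-- no longer dominated, and if i ∈ u then, for some j ∈ u and some k, the sets
-- ⁅ j , k ⁆ and ⁅ i , j , k ⁆ have the same neighbours in the exchanged set. The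
-- non-singletons also form a locating-dominating set, and any minimal one inside it
-- contains a vertex u as above.

module Submission where

open import Defs
open import Algebra.Module.Bundles using (Module)
import Algebra.Properties.CommutativeMonoid.Sum as Sum
import Algebra.Properties.Group as GroupProperties
open import Data.Bool.Base using (true; false; T; not; if_then_else_)
import Data.Bool.Properties as Bool using (_≟_)
open import Data.Bool.Properties using (T-≡)
open import Data.Fin.Base using (Fin; zero; suc; toℕ; funToFin; finToFun; fromℕ<)
open import Data.Fin.Properties
  using (any?; pigeonhole; ¬∀⟶∃¬; toℕ-injective; toℕ<n; finToFun-funToFin; 2↔Bool)
  renaming (_≟_ to _≟ᶠ_)
open import Data.Fin.Subset using (Subset; Nonempty; ⁅_⁆; _∈_; _∉_; _∪_)
open import Data.Fin.Subset.Properties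
  using (_∈?_; nonempty?; x∈⁅x⁆; x∈⁅y⁆⇒x≡y; ⊆-antisym; x∈p∪q⁺; x∈p∪q⁻)
open import Data.Nat.Base using (ℕ; zero; suc; _<_; _>_; _^_; s≤s; z≤n)
open import Data.Nat.Properties using (m<1+n⇒m<n∨m≡n; ≤-trans; <-irrefl; <-trans; n<1+n)
open import Data.Product.Base using (∃-syntax; _×_; _,_; proj₁; proj₂)
open import Data.Sum.Base using (_⊎_; inj₁; inj₂; [_,_]′)
open import Data.Vec.Base using ([]; _∷_; lookup; tabulate)
open import Data.Vec.Properties using (≡-dec; []=⇒lookup; lookup⇒[]=; lookup∘tabulate)
open import Function.Base using (_∘_; case_of_)
open import Function.Bundles using (Injection; Inverse; Equivalence; Func; Bijection)
import Function.Construct.Composition as Composition using (injection)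
open import Level using (_⊔_)
open import Relation.Binary.Bundles using (Setoid)
open import Relation.Binary.PropositionalEquality.Core
  using (_≡_; _≢_; refl; sym; trans; cong; subst)
import Relation.Binary.PropositionalEquality.Properties as ≡
open import Relation.Nullary.Decidable
  using (Dec; yes; no; ⌊_⌋; ¬?; _×-dec_; T?; decidable-stable; via-injection;
         toWitness; fromWitness; toWitnessFalse; fromWitnessFalse)
open import Relation.Nullary.Negation using (¬_; contradiction)
open import Relation.Unary using (_⊆_; _≐_; _∩_; Decidable)
import Relation.Unary as Unary using (_∖_; _∪_)

-- Finite combinatorics: pigeonhole and coding subsets by numbers.

-- If every element were hit, choosing preimages would map `Fin n` to the smaller `Fin m`, and two
-- elements sharing a preimage coincide. Applied to `lookup` of a short list, this yields an index
-- avoiding the listed ones.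
missed : ∀ {m n} → m < n → (f : Fin m → Fin n) → ∃[ x ] (∀ k → f k ≢ x)
missed {m} {n} m<n f =
  let x , unhit = ¬∀⟶∃¬ n (λ x → ∃[ k ] f k ≡ x) (λ x → any? λ k → f k ≟ᶠ x) not-surjective
  in x , λ k fk≡x → unhit (k , fk≡x)
  where
  not-surjective : ¬ (∀ x → ∃[ k ] f k ≡ x)
  not-surjective hit =
    let x , y , x<y , same = pigeonhole m<n (proj₁ ∘ hit)
        x≡y = trans (sym (proj₂ (hit x))) (trans (cong f same) (proj₂ (hit y)))
    in <-irrefl (cong toℕ x≡y) x<y

-- `z` is arbitrary because a bijection from the field to `Fin 2` may send zero to either element.
Fin2-nonzero-unique : ∀ {x y z : Fin 2} → x ≢ z → y ≢ z → x ≡ y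
Fin2-nonzero-unique {zero}     {zero}                _   _   = refl
Fin2-nonzero-unique {suc zero} {suc zero}            _   _   = refl
Fin2-nonzero-unique {zero}     {suc zero} {zero}     x≢z _   = contradiction refl x≢z
Fin2-nonzero-unique {zero}     {suc zero} {suc zero} _   y≢z = contradiction refl y≢z
Fin2-nonzero-unique {suc zero} {zero}     {zero}     _   y≢z = contradiction refl y≢z
Fin2-nonzero-unique {suc zero} {zero}     {suc zero} x≢z _   = contradiction refl x≢z

-- The characteristic function of a subset is read as a string of binary digits. This numbers the
-- vertices, as the search for a minimal set requires.
Subset↣Fin : ∀ n → Injection (≡.setoid (Subset n)) (≡.setoid (Fin (2 ^ n)))
Subset↣Fin n = record
  { to        = encode
  ; cong      = cong encode
  ; injective = λ {p} {q} eq → ⊆-antisym (encode-⊆ p q eq) (encode-⊆ q p (sym eq))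
  }
  where
  digits : Subset n → Fin n → Fin 2
  digits p i = Inverse.from 2↔Bool (lookup p i)

  encode : Subset n → Fin (2 ^ n)
  encode = funToFin ∘ digits

  decode-encode : ∀ p i → Inverse.to 2↔Bool (finToFun (encode p) i) ≡ lookup p i
  decode-encode p i = trans (cong (Inverse.to 2↔Bool) (finToFun-funToFin (digits p) i))
    (Inverse.strictlyInverseˡ 2↔Bool (lookup p i))

  encode-⊆ : ∀ p q → encode p ≡ encode q → ∀ {i} → i ∈ p → i ∈ q
  encode-⊆ p q eq {i} i∈p = lookup⇒[]= i q
    (trans (sym (decode-encode q i))
      (trans (cong (λ c → Inverse.to 2↔Bool (finToFun c i)) (sym eq))
        (trans (decode-encode p i) ([]=⇒lookup i∈p))))

module _ {n a} {P : Fin n → Set a} (P? : Decidable P) where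

  comprehension : Subset n
  comprehension = tabulate (λ i → ⌊ P? i ⌋)

  ∈-comprehension⁺ : ∀ {i} → P i → i ∈ comprehension
  ∈-comprehension⁺ {i} Pi = lookup⇒[]= i comprehension
    (trans (lookup∘tabulate _ i) (Equivalence.to T-≡ (fromWitness Pi)))

  ∈-comprehension⁻ : ∀ {i} → i ∈ comprehension → P i
  ∈-comprehension⁻ {i} i∈ = toWitness
    (Equivalence.from T-≡ (trans (sym (lookup∘tabulate _ i)) ([]=⇒lookup i∈)))

-- Minimal locating-dominating sets in finite graphs.

module _ {v ℓ e} (Γ : SimpleGraph v ℓ e) where
  open SimpleGraph Γ
  open LocatingDomination Γ

  module _ {m} (code : Injection vertices (≡.setoid (Fin m))) where
    open Injection code using (to; injective)

    -- Vertices are discarded one at a time in the order of their codes; whether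
    -- a vertex can be discarded is undecidable in general, hence the double
    -- negation.
    ¬¬∃-minimal⊆ : ∀ L → IsLocatingDominating ⟦ L ⟧ →
      ¬ ¬ (∃[ K ] IsMinimalLocatingDominating ⟦ K ⟧ × ⟦ K ⟧ ⊆ ⟦ L ⟧)
    ¬¬∃-minimal⊆ L L-ld ¬∃ = thin m λ (K , K-ld , K⊆L , settled) →
      ¬∃ (K , (K-ld , λ K′ K′-ld K′⊆K {y} → settled y (toℕ<n (to y)) K′ K′-ld K′⊆K) , K⊆L)
      where
      -- The invariant of the search: vertices of `K` with code below `k` can no longer be dropped.
      -- At `k = m` it covers every vertex and is exactly minimality.
      Settled : VertexSet → ℕ → Set _
      Settled K k = ∀ y → toℕ (to y) < k → ∀ K′ → IsLocatingDominating ⟦ K′ ⟧ →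
        ⟦ K′ ⟧ ⊆ ⟦ K ⟧ → ⟦ K ⟧ y → ⟦ K′ ⟧ y

      thin : ∀ k → ¬ ¬ (∃[ K ] IsLocatingDominating ⟦ K ⟧ × ⟦ K ⟧ ⊆ ⟦ L ⟧ × Settled K k)
      thin zero    none = none (L , L-ld , (λ y∈L → y∈L) , λ _ ())
      thin (suc k) none = thin k step
        where
        step : ¬ (∃[ K ] IsLocatingDominating ⟦ K ⟧ × ⟦ K ⟧ ⊆ ⟦ L ⟧ × Settled K k)
        -- Either `K` is already settled at `suc k`, or some `K′` inside it omits the vertex with
        -- code `k`, and then `K′` is settled there.
        step (K , K-ld , K⊆L , settled) = none (K , K-ld , K⊆L , settled⁺)
          where
          settled⁺ : Settled K (suc k)
          settled⁺ y y<1+k K′ K′-ld K′⊆K y∈K with m<1+n⇒m<n∨m≡n y<1+k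
          ... | inj₁ y<k = settled y y<k K′ K′-ld K′⊆K y∈K
          ... | inj₂ y≡k = decidable-stable (T? _) λ y∉K′ →
            none (K′ , K′-ld , (λ z∈K′ → K⊆L (K′⊆K z∈K′)) , settled′ y∉K′)
            where
            settled′ : ¬ ⟦ K′ ⟧ y → Settled K′ (suc k)
            settled′ y∉K′ z z<1+k K″ K″-ld K″⊆K′ z∈K′ with m<1+n⇒m<n∨m≡n z<1+k
            ... | inj₁ z<k = settled z z<k K″ K″-ld (λ x∈K″ → K′⊆K (K″⊆K′ x∈K″)) (K′⊆K z∈K′)
            ... | inj₂ z≡k = contradiction (subst T (Func.cong K′ z≈y) z∈K′) y∉K′
              where
              z≈y : z ≈ y
              z≈y = injective (toℕ-injective (trans z≡k (sym y≡k)))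

-- Γ is, up to _≈_, the intersection graph of all non-empty subsets of Fin n.
record IsIntersectionGraph {v ℓ e} (Γ : SimpleGraph v ℓ e) (n : ℕ) : Set (v ⊔ ℓ ⊔ e) where
  open SimpleGraph Γ
  field
    support         : Injection vertices (≡.setoid (Subset n))
  open Injection support public using ()
    renaming (to to supp; cong to supp-cong; injective to supp-injective)
  field
    supp-nonempty   : ∀ u → Nonempty (supp u)
    supp-surjective : ∀ p → Nonempty p → ∃[ u ] supp u ≡ p
    adjacent⇒meet   : ∀ {u w} → Adjacent u w → ∃[ i ] i ∈ supp u × i ∈ supp w
    meet⇒adjacent   : ∀ {u w i} → ¬ u ≈ w → i ∈ supp u → i ∈ supp w → Adjacent u w

-- Singletons and non-singletons in the intersection graph.

module _ {v ℓ e n} {Γ : SimpleGraph v ℓ e} (R : IsIntersectionGraph Γ n) where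
  open SimpleGraph Γ
  open LocatingDomination Γ
  open IsIntersectionGraph R
  private module ≈ = Setoid vertices

  IsSingleton : Vertex → Set
  IsSingleton u = ∃[ i ] supp u ≡ ⁅ i ⁆

  isSingleton? : Decidable IsSingleton
  isSingleton? u = any? λ i → ≡-dec Bool._≟_ (supp u) ⁅ i ⁆

  isSingleton-resp : ∀ {u w} → u ≈ w → IsSingleton u → IsSingleton w
  isSingleton-resp u≈w (i , u≡i) = i , trans (sym (supp-cong u≈w)) u≡i

  two-elements⇒¬isSingleton : ∀ {u i j} → i ≢ j → i ∈ supp u → j ∈ supp u → ¬ IsSingleton u
  two-elements⇒¬isSingleton i≢j i∈u j∈u (k , u≡k) =
    i≢j (trans (x∈⁅y⁆⇒x≡y k (subst (_ ∈_) u≡k i∈u)) (sym (x∈⁅y⁆⇒x≡y k (subst (_ ∈_) u≡k j∈u))))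

  singletons : VertexSet
  singletons = record
    { to   = λ u → ⌊ isSingleton? u ⌋
    ; cong = λ u≈w → cong (λ p → ⌊ any? (λ i → ≡-dec Bool._≟_ p ⁅ i ⁆) ⌋) (supp-cong u≈w)
    }

  nonSingletons : VertexSet
  nonSingletons = record
    { to   = not ∘ Func.to singletons
    ; cong = cong not ∘ Func.cong singletons
    }

  singleton : Fin n → Vertex
  singleton i = proj₁ (supp-surjective ⁅ i ⁆ (i , x∈⁅x⁆ i))

  supp-singleton : ∀ i → supp (singleton i) ≡ ⁅ i ⁆
  supp-singleton i = proj₂ (supp-surjective ⁅ i ⁆ (i , x∈⁅x⁆ i))

  ∈-singleton : ∀ i → i ∈ supp (singleton i)
  ∈-singleton i = subst (i ∈_) (sym (supp-singleton i)) (x∈⁅x⁆ i)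

  ∈-singleton⁻ : ∀ {i u j} → supp u ≡ ⁅ j ⁆ → i ∈ supp u → i ≡ j
  ∈-singleton⁻ {j = j} u≡j i∈u = x∈⁅y⁆⇒x≡y j (subst (_ ∈_) u≡j i∈u)

  ∈-singletons : ∀ {u i} → supp u ≡ ⁅ i ⁆ → ⟦ singletons ⟧ u
  ∈-singletons {i = i} u≡i = fromWitness (i , u≡i)

  insert : Fin n → Vertex → Vertex
  insert i u = proj₁ (supp-surjective (⁅ i ⁆ ∪ supp u) (i , x∈p∪q⁺ (inj₁ (x∈⁅x⁆ i))))

  supp-insert : ∀ i u → supp (insert i u) ≡ ⁅ i ⁆ ∪ supp u
  supp-insert i u = proj₂ (supp-surjective (⁅ i ⁆ ∪ supp u) (i , x∈p∪q⁺ (inj₁ (x∈⁅x⁆ i))))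

  ∈-insertˡ : ∀ i u → i ∈ supp (insert i u)
  ∈-insertˡ i u = subst (i ∈_) (sym (supp-insert i u)) (x∈p∪q⁺ (inj₁ (x∈⁅x⁆ i)))

  ∈-insertʳ : ∀ {i j u} → j ∈ supp u → j ∈ supp (insert i u)
  ∈-insertʳ {i} {j} {u} j∈u = subst (j ∈_) (sym (supp-insert i u)) (x∈p∪q⁺ (inj₂ j∈u))

  ∈-insert⁻ : ∀ {i j u} → j ∈ supp (insert i u) → j ≡ i ⊎ j ∈ supp u
  ∈-insert⁻ {i} {j} {u} j∈ with x∈p∪q⁻ ⁅ i ⁆ (supp u) (subst (j ∈_) (supp-insert i u) j∈)
  ... | inj₁ j∈i = inj₁ (x∈⁅y⁆⇒x≡y i j∈i)
  ... | inj₂ j∈u = inj₂ j∈u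

  pair : Fin n → Fin n → Vertex
  pair i j = insert i (singleton j)

  ∈-pair⁻ : ∀ {i j k} → k ∈ supp (pair i j) → k ≡ i ⊎ k ≡ j
  ∈-pair⁻ {i} {j} k∈ with ∈-insert⁻ k∈
  ... | inj₁ k≡i = inj₁ k≡i
  ... | inj₂ k∈j = inj₂ (∈-singleton⁻ (supp-singleton j) k∈j)

  pair-¬isSingleton : ∀ {i j} → i ≢ j → ¬ IsSingleton (pair i j)
  pair-¬isSingleton {i} {j} i≢j =
    two-elements⇒¬isSingleton i≢j (∈-insertˡ i _) (∈-insertʳ (∈-singleton j))

  adjacent-singleton : ∀ {u i} → ¬ IsSingleton u → i ∈ supp u → Adjacent u (singleton i)
  adjacent-singleton {u} {i} ¬single i∈u = meet⇒adjacent
    (λ u≈i → ¬single (isSingleton-resp (≈.sym u≈i) (i , supp-singleton i))) i∈u (∈-singleton i)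

  -- The singletons adjacent to a non-singleton are those of the elements of its support, so they
  -- determine the support and hence the vertex.
  singletons-locatingDominating : IsLocatingDominating ⟦ singletons ⟧
  singletons-locatingDominating u w u∉ w∉ u≉w =
    dominated u u∉ , located , dominated w w∉
    where
    dominated : ∀ u → ¬ ⟦ singletons ⟧ u → ∃[ z ] Adjacent u z × ⟦ singletons ⟧ z
    dominated u u∉ = let i , i∈u = supp-nonempty u in
      singleton i , adjacent-singleton (u∉ ∘ fromWitness) i∈u , ∈-singletons (supp-singleton i)

    supp-⊆ : ∀ u w → ¬ ⟦ singletons ⟧ u →
      N u ∩ ⟦ singletons ⟧ ⊆ N w ∩ ⟦ singletons ⟧ → ∀ {i} → i ∈ supp u → i ∈ supp w
    supp-⊆ u w u∉ u⊆w {i} i∈u =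
      let adj , _ = u⊆w (adjacent-singleton (u∉ ∘ fromWitness) i∈u , ∈-singletons (supp-singleton i))
          j , j∈w , j∈i = adjacent⇒meet adj
      in subst (_∈ supp w) (∈-singleton⁻ (supp-singleton i) j∈i) j∈w

    located : ¬ (N u ∩ ⟦ singletons ⟧ ≐ N w ∩ ⟦ singletons ⟧)
    located (u⊆w , w⊆u) =
      u≉w (supp-injective (⊆-antisym (supp-⊆ u w u∉ u⊆w) (supp-⊆ w u w∉ w⊆u)))

  module _ (2<n : 2 < n) where

    another : ∀ i j → ∃[ k ] k ≢ i × k ≢ j
    another i j = let k , k-new = missed 2<n (lookup (i ∷ j ∷ [])) in
      k , (k-new zero ∘ sym) , (k-new (suc zero) ∘ sym)

    -- Distinct singletons are disjoint, so a singleton left out of `K` has no neighbour among the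
    -- other singletons and is not dominated.
    singletons-minimal : IsMinimalLocatingDominating ⟦ singletons ⟧
    singletons-minimal = singletons-locatingDominating , minimal
      where
      minimal : ∀ K → IsLocatingDominating ⟦ K ⟧ → ⟦ K ⟧ ⊆ ⟦ singletons ⟧ → ⟦ singletons ⟧ ⊆ ⟦ K ⟧
      minimal K K-ld K⊆ {u} u∈ = decidable-stable (T? _) λ u∉K →
        let i , u≡i = toWitness u∈
            j , j≢i , _ = another i i
            ¬single = pair-¬isSingleton j≢i
            -- Domination is stated for two distinct vertices outside the set; the non-singleton
            -- `pair j i` accompanies `u`.
            (z , adj , z∈K) , _ = K-ld u (pair j i) u∉K (¬single ∘ toWitness ∘ K⊆)
              (λ u≈ → ¬single (isSingleton-resp u≈ (i , u≡i)))
            k , z≡k = toWitness (K⊆ z∈K)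
            l , l∈u , l∈z = adjacent⇒meet adj
            i≡k = trans (sym (∈-singleton⁻ u≡i l∈u)) (∈-singleton⁻ z≡k l∈z)
        in u∉K (subst T (Func.cong K (supp-injective
             (trans z≡k (trans (cong ⁅_⁆ (sym i≡k)) (sym u≡i))))) z∈K)

    -- For `⁅ i ⁆` and `⁅ j ⁆` distinct and `k` different from both, `pair k i` meets the first but
    -- not the second, and `pair k j` dominates the second.
    nonSingletons-locatingDominating : IsLocatingDominating ⟦ nonSingletons ⟧
    nonSingletons-locatingDominating u w u∉ w∉ u≉w
      with i , u≡i ← decidable-stable (isSingleton? u) (u∉ ∘ fromWitnessFalse)
         | j , w≡j ← decidable-stable (isSingleton? w) (w∉ ∘ fromWitnessFalse) =
      let k , k≢i , k≢j = another i j
      in (pair k i , near u≡i k≢i) , (λ (u⊆w , _) → far w≡j u≡i k≢j (u⊆w (near u≡i k≢i)))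
       , (pair k j , near w≡j k≢j)
      where
      near : ∀ {u i k} → supp u ≡ ⁅ i ⁆ → k ≢ i → (N u ∩ ⟦ nonSingletons ⟧) (pair k i)
      near {i = i} u≡i k≢i =
          meet⇒adjacent (λ u≈ → pair-¬isSingleton k≢i (isSingleton-resp u≈ (i , u≡i)))
            (subst (i ∈_) (sym u≡i) (x∈⁅x⁆ i)) (∈-insertʳ (∈-singleton i))
        , fromWitnessFalse (pair-¬isSingleton k≢i)

      far : ∀ {i j k} → supp w ≡ ⁅ j ⁆ → supp u ≡ ⁅ i ⁆ → k ≢ j →
        ¬ (N w ∩ ⟦ nonSingletons ⟧) (pair k i)
      far w≡j u≡i k≢j (adj , _) with l , l∈w , l∈ ← adjacent⇒meet adj | ∈-pair⁻ l∈
      ... | inj₁ l≡k = k≢j (trans (sym l≡k) (∈-singleton⁻ w≡j l∈w))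
      ... | inj₂ l≡i = u≉w (supp-injective
        (trans u≡i (trans (cong ⁅_⁆ (trans (sym l≡i) (∈-singleton⁻ w≡j l∈w))) (sym w≡j))))

    -- Exchanging a singleton for a non-singleton.

    module _ {r i u} (r≡i : supp r ≡ ⁅ i ⁆) (¬single : ¬ IsSingleton u) where

      Exchanged : Vertex → Set _
      Exchanged = (⟦ singletons ⟧ Unary.∖ ｛ r ｝) Unary.∪ ｛ u ｝

      exchanged-resp : ∀ {x y} → x ≈ y → Exchanged x → Exchanged y
      exchanged-resp x≈y (inj₁ (x∈ , x≉r)) =
        inj₁ (subst T (Func.cong singletons x≈y) x∈ , x≉r ∘ ≈.trans x≈y)
      exchanged-resp x≈y (inj₂ x≈u) = inj₂ (≈.trans (≈.sym x≈y) x≈u)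

      ∉-exchanged : ∀ {x} → ¬ IsSingleton x → ¬ x ≈ u → ¬ Exchanged x
      ∉-exchanged ¬single-x x≉u = [ ¬single-x ∘ toWitness ∘ proj₁ , x≉u ]′

      -- The only singleton containing `i` is `r`, which has been removed.
      ∈-exchanged⇒≈ : ∀ {z} → Exchanged z → i ∈ supp z → z ≈ u
      ∈-exchanged⇒≈ (inj₁ (z∈ , z≉r)) i∈z = let k , z≡k = toWitness z∈ in
        contradiction (supp-injective
          (trans z≡k (trans (cong ⁅_⁆ (sym (∈-singleton⁻ z≡k i∈z))) (sym r≡i)))) z≉r
      ∈-exchanged⇒≈ (inj₂ z≈u) _ = z≈u

      -- A neighbour of `r` contains `i`, and in the exchanged set only `u` could.
      undominated : i ∉ supp u → ¬ IsLocatingDominating Exchanged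
      undominated i∉u ld =
        let j , j≢i , _ = another i i
            -- The companion `pair j i` contains `i`, so it is not `u`.
            (z , adj , z∈) , _ = ld r (pair j i) r∉
              (∉-exchanged (pair-¬isSingleton j≢i)
                λ eq → i∉u (subst (i ∈_) (supp-cong eq) (∈-insertʳ (∈-singleton i))))
              (λ eq → pair-¬isSingleton j≢i (isSingleton-resp eq (i , r≡i)))
            k , k∈r , k∈z = adjacent⇒meet adj
            i∈z = subst (_∈ supp z) (∈-singleton⁻ r≡i k∈r) k∈z
        in i∉u (subst (i ∈_) (supp-cong (∈-exchanged⇒≈ z∈ i∈z)) i∈z)
        where
        r∉ : ¬ Exchanged r
        r∉ (inj₁ (_ , r≉r)) = r≉r ≈.refl
        r∉ (inj₂ r≈u) = ¬single (isSingleton-resp r≈u (i , r≡i))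

      -- The supports of `x` and `y` differ only in `i`. The only member of the exchanged set that
      -- contains `i` is `u`, which also contains `j` and so is adjacent to both.
      twins : ∀ {j k} → i ∈ supp u → j ∈ supp u → i ≢ j → k ≢ i → k ≢ j →
        ¬ insert i (pair k j) ≈ u → ¬ IsLocatingDominating Exchanged
      twins {j} {k} i∈u j∈u i≢j k≢i k≢j y≉u ld =
        proj₁ (proj₂ (ld x y x∉ y∉ x≉y)) (x⊆y , y⊆x)
        where
        x y : Vertex
        x = pair k j
        y = insert i x

        i∉x : i ∉ supp x
        i∉x i∈x = [ k≢i ∘ sym , i≢j ]′ (∈-pair⁻ i∈x)

        j∈x : j ∈ supp x
        j∈x = ∈-insertʳ (∈-singleton j)

        x∉ : ¬ Exchanged x
        x∉ = ∉-exchanged (pair-¬isSingleton k≢j)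
          λ x≈u → i∉x (subst (i ∈_) (sym (supp-cong x≈u)) i∈u)

        y∉ : ¬ Exchanged y
        y∉ = ∉-exchanged
          (two-elements⇒¬isSingleton k≢j (∈-insertʳ (∈-insertˡ k _)) (∈-insertʳ j∈x)) y≉u

        x≉y : ¬ x ≈ y
        x≉y x≈y = i∉x (subst (i ∈_) (sym (supp-cong x≈y)) (∈-insertˡ i x))

        x⊆y : N x ∩ Exchanged ⊆ N y ∩ Exchanged
        x⊆y (adj , z∈) = let l , l∈x , l∈z = adjacent⇒meet adj in
          meet⇒adjacent (λ y≈z → y∉ (exchanged-resp (≈.sym y≈z) z∈)) (∈-insertʳ l∈x) l∈z , z∈

        y⊆x : N y ∩ Exchanged ⊆ N x ∩ Exchanged
        y⊆x {z} (adj , z∈) = let l , l∈y , l∈z = adjacent⇒meet adj in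
          (case ∈-insert⁻ l∈y of λ where
            -- A neighbour of `y` through `i` is `u`, which meets `x` in `j`.
            (inj₁ l≡i) → meet⇒adjacent x≉z j∈x (subst (j ∈_)
              (sym (supp-cong (∈-exchanged⇒≈ z∈ (subst (_∈ supp z) l≡i l∈z)))) j∈u)
            (inj₂ l∈x) → meet⇒adjacent x≉z l∈x l∈z)
          , z∈
          where
          x≉z : ¬ x ≈ z
          x≉z x≈z = x∉ (exchanged-resp (≈.sym x≈z) z∈)

  -- Failure of the exchange property.

  module _ (3<n : 3 < n) where

    2<n : 2 < n
    2<n = <-trans (n<1+n 2) 3<n

    not-exchangeable : ∀ {r i u} → supp r ≡ ⁅ i ⁆ → ¬ IsSingleton u →
      ¬ IsLocatingDominating ((⟦ singletons ⟧ Unary.∖ ｛ r ｝) Unary.∪ ｛ u ｝)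
    not-exchangeable {r} {i} {u} r≡i ¬single ld with i ∈? supp u
    ... | no i∉u = undominated 2<n r≡i ¬single i∉u ld
    -- Without such a `j` the support of `u` would be `⁅ i ⁆`.
    ... | yes i∈u with any? (λ j → j ∈? supp u ×-dec ¬? (i ≟ᶠ j))
    ...   | no none = ¬single (i , ⊆-antisym u⊆i i⊆u)
      where
      u⊆i : ∀ {j} → j ∈ supp u → j ∈ ⁅ i ⁆
      u⊆i {j} j∈u = subst (_∈ ⁅ i ⁆)
        (decidable-stable (i ≟ᶠ j) λ i≢j → none (j , j∈u , i≢j)) (x∈⁅x⁆ i)

      i⊆u : ∀ {j} → j ∈ ⁅ i ⁆ → j ∈ supp u
      i⊆u j∈i = subst (_∈ supp u) (sym (x∈⁅y⁆⇒x≡y i j∈i)) i∈u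
    ...   | yes (j , j∈u , i≢j) with another 2<n i j
    ...     | k , k≢i , k≢j with k ∈? supp u
    -- Here `k` separates the three-element set from `u`, as `twins` demands.
    ...       | no k∉u = twins 2<n r≡i ¬single i∈u j∈u i≢j k≢i k≢j
      (λ y≈u → k∉u (subst (k ∈_) (supp-cong y≈u) (∈-insertʳ (∈-insertˡ k _)))) ld
    -- Now `u` could be the set of `i`, `j` and `k`, so a fourth index `l` replaces `k`; it exists
    -- because `3 < n`. Then `k` lies in `u` but not in the set of `i`, `j` and `l`.
    ...       | yes k∈u = twins 2<n r≡i ¬single i∈u j∈u i≢j
      (l-new zero ∘ sym) (l-new (suc zero) ∘ sym) y≉u ld
      where
      l : Fin n
      l = proj₁ (missed 3<n (lookup (i ∷ j ∷ k ∷ [])))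

      l-new : ∀ m → lookup (i ∷ j ∷ k ∷ []) m ≢ l
      l-new = proj₂ (missed 3<n (lookup (i ∷ j ∷ k ∷ [])))

      y≉u : ¬ insert i (pair l j) ≈ u
      y≉u y≈u with ∈-insert⁻ (subst (k ∈_) (sym (supp-cong y≈u)) k∈u)
      ... | inj₁ k≡i = k≢i k≡i
      ... | inj₂ k∈ = [ l-new (suc (suc zero)) , k≢j ]′ (∈-pair⁻ k∈)

    ¬exchangeProperty : ¬ ExchangeProperty
    ¬exchangeProperty exchange =
      -- The goal is a contradiction, so a minimal set under double negation suffices.
      ¬¬∃-minimal⊆ Γ code nonSingletons (nonSingletons-locatingDominating 2<n)
        λ (L , L-min@(L-ld , _) , L⊆) →
          let i = fromℕ< (≤-trans (s≤s z≤n) 3<n)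
              j , j≢i , _ = another 2<n i i
              single∉L = λ k k∈L →
                toWitnessFalse (L⊆ {singleton k} k∈L) (k , supp-singleton k)
              -- Two singletons lie outside `L`; dominating the first supplies a member `u` of `L`,
              -- to be exchanged into `singletons`.
              (u , _ , u∈L) , _ = L-ld (singleton i) (singleton j) (single∉L i) (single∉L j)
                λ i≈j → j≢i (sym (∈-singleton⁻ (supp-singleton j)
                  (subst (i ∈_) (supp-cong i≈j) (∈-singleton i))))
              r , r∈ , ld , _ = exchange L singletons L-min (singletons-minimal 2<n) u u∈L
          in not-exchangeable (proj₂ (toWitness r∈)) (toWitnessFalse (L⊆ u∈L)) ld
      where
      code : Injection vertices (≡.setoid (Fin (2 ^ n)))
      code = Composition.injection support (Subset↣Fin n)

-- Coordinates with respect to a basis.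

module _ {c ℓ m ℓm} (F : Field c ℓ) (V : VectorSpace F m ℓm) {n : ℕ} (b : Basis F V n) where
  private
    module F = Field F
    module V = Module V
  open Basis b
  open Sum V.+ᴹ-commutativeMonoid using (sum-cong-≋; sum-replicate-zero; ∑-distrib-+)

  private
    lc : (Fin n → F.Carrier) → V.Carrierᴹ
    lc = linearCombination F V vector

  lc-zero : ∀ a → (∀ i → a i F.≈ F.0#) → lc a V.≈ᴹ V.0ᴹ
  lc-zero a a≈0 = V.≈ᴹ-trans
    (sum-cong-≋ λ i → V.≈ᴹ-trans (V.*ₗ-congʳ (a≈0 i)) (V.*ₗ-zeroˡ (vector i)))
    (sum-replicate-zero n)

  lc-injective : ∀ a a′ → lc a V.≈ᴹ lc a′ → ∀ i → a i F.≈ a′ i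
  lc-injective a a′ a≈a′ i =
    GroupProperties.x∙y⁻¹≈ε⇒x≈y F.+-group (a i) (a′ i) (independent d d≈0 i)
    where
    d : Fin n → F.Carrier
    d i = a i F.+ (F.- a′ i)

    d+a′ : lc d V.+ᴹ lc a′ V.≈ᴹ lc a
    d+a′ = V.≈ᴹ-trans
      (V.≈ᴹ-sym (∑-distrib-+ (λ i → d i V.*ₗ vector i) (λ i → a′ i V.*ₗ vector i)))
      (sum-cong-≋ λ i → V.≈ᴹ-trans (V.≈ᴹ-sym (V.*ₗ-distribʳ (vector i) (d i) (a′ i)))
        (V.*ₗ-congʳ (GroupProperties.//-rightDividesˡ F.+-group (a′ i) (a i))))

    d≈0 : lc d V.≈ᴹ V.0ᴹ
    -- Since `lc d` added to `lc a′` gives `lc a′` back, it is zero.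
    d≈0 = GroupProperties.identityˡ-unique V.+ᴹ-group (lc d) (lc a′) (V.≈ᴹ-trans d+a′ a≈a′)

  -- The coefficients chosen by `spanning`; that they respect `≈ᴹ` comes from independence, through
  -- `coordinate-unique`.
  coordinate : V.Carrierᴹ → Fin n → F.Carrier
  coordinate v = proj₁ (spanning v)

  ≈-lc-coordinate : ∀ v → v V.≈ᴹ lc (coordinate v)
  ≈-lc-coordinate v = proj₂ (spanning v)

  coordinate-unique : ∀ {v} a → v V.≈ᴹ lc a → ∀ i → coordinate v i F.≈ a i
  coordinate-unique {v} a v≈a =
    lc-injective (coordinate v) a (V.≈ᴹ-trans (V.≈ᴹ-sym (≈-lc-coordinate v)) v≈a)

  coordinate-cong : ∀ {u v} → u V.≈ᴹ v → ∀ i → coordinate u i F.≈ coordinate v i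
  coordinate-cong {u} {v} u≈v =
    coordinate-unique (coordinate v) (V.≈ᴹ-trans u≈v (≈-lc-coordinate v))

  coordinate-injective : ∀ {u v} → (∀ i → coordinate u i F.≈ coordinate v i) → u V.≈ᴹ v
  coordinate-injective {u} {v} u≈v = V.≈ᴹ-trans (≈-lc-coordinate u)
    (V.≈ᴹ-trans (sum-cong-≋ λ i → V.*ₗ-congʳ (u≈v i)) (V.≈ᴹ-sym (≈-lc-coordinate v)))

  -- Vectors over the two-element field as subsets.

  module _ (F-card : HasCardinality F.setoid 2) where
    private
      module card = Bijection F-card

    _≟0 : ∀ x → Dec (x F.≈ F.0#)
    x ≟0 = via-injection card.injection _≟ᶠ_ x F.0#

    nonzero-unique : ∀ {x y} → ¬ x F.≈ F.0# → ¬ y F.≈ F.0# → x F.≈ y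
    nonzero-unique x≉0 y≉0 =
      card.injective (Fin2-nonzero-unique (x≉0 ∘ card.injective) (y≉0 ∘ card.injective))

    nonzero? : ∀ v → Decidable (λ i → ¬ coordinate v i F.≈ F.0#)
    nonzero? v i = ¬? (coordinate v i ≟0)

    vectorSupport : V.Carrierᴹ → Subset n
    vectorSupport v = comprehension (nonzero? v)

    ∈-vectorSupport⁻ : ∀ {v i} → i ∈ vectorSupport v → HasNonZeroCoefficient F V b v i
    ∈-vectorSupport⁻ {v} i∈v =
      coordinate v , ≈-lc-coordinate v , ∈-comprehension⁻ (nonzero? v) i∈v

    ∈-vectorSupport⁺ : ∀ {v i} → HasNonZeroCoefficient F V b v i → i ∈ vectorSupport v
    ∈-vectorSupport⁺ {v} {i} (a , v≈a , ai≉0) = ∈-comprehension⁺ (nonzero? v)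
      λ vi≈0 → ai≉0 (F.trans (F.sym (coordinate-unique a v≈a i)) vi≈0)

    vectorSupport-⊆ : ∀ {u v} → u V.≈ᴹ v → ∀ {i} → i ∈ vectorSupport u → i ∈ vectorSupport v
    vectorSupport-⊆ {u} {v} u≈v {i} i∈u = ∈-comprehension⁺ (nonzero? v) λ vi≈0 →
      ∈-comprehension⁻ (nonzero? u) i∈u (F.trans (coordinate-cong u≈v i) vi≈0)

    -- A non-zero coordinate has only one possible value, so knowing which coordinates vanish fixes
    -- them all.
    vectorSupport-injective : ∀ {u v} → vectorSupport u ≡ vectorSupport v → u V.≈ᴹ v
    vectorSupport-injective {u} {v} eq = coordinate-injective agree
      where
      agree : ∀ i → coordinate u i F.≈ coordinate v i
      agree i with coordinate u i ≟0 | coordinate v i ≟0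
      ... | yes ui≈0 | yes vi≈0 = F.trans ui≈0 (F.sym vi≈0)
      ... | no  ui≉0 | no  vi≉0 = nonzero-unique ui≉0 vi≉0
      ... | yes ui≈0 | no  vi≉0 = contradiction ui≈0 (∈-comprehension⁻ (nonzero? u)
        (subst (i ∈_) (sym eq) (∈-comprehension⁺ (nonzero? v) vi≉0)))
      ... | no  ui≉0 | yes vi≈0 = contradiction vi≈0 (∈-comprehension⁻ (nonzero? v)
        (subst (i ∈_) eq (∈-comprehension⁺ (nonzero? u) ui≉0)))

    vectorSupport-nonempty : ∀ {v} → ¬ v V.≈ᴹ V.0ᴹ → Nonempty (vectorSupport v)
    vectorSupport-nonempty {v} v≉0 = decidable-stable (nonempty? _) λ empty →
      v≉0 (V.≈ᴹ-trans (≈-lc-coordinate v) (lc-zero (coordinate v) λ i →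
        decidable-stable (_ ≟0) λ vi≉0 → empty (i , ∈-comprehension⁺ (nonzero? v) vi≉0)))

    indicator : Subset n → Fin n → F.Carrier
    indicator p i = if lookup p i then F.1# else F.0#

    ∈⇒indicator≉0 : ∀ {p i} → i ∈ p → ¬ indicator p i F.≈ F.0#
    ∈⇒indicator≉0 i∈p rewrite []=⇒lookup i∈p = F.1≉0

    indicator≉0⇒∈ : ∀ {p i} → ¬ indicator p i F.≈ F.0# → i ∈ p
    indicator≉0⇒∈ {p} {i} ≉0 with lookup p i in eq
    ... | true  = lookup⇒[]= i p eq
    ... | false = contradiction F.refl ≉0

    -- By uniqueness the coordinates of this combination are the values of `indicator p`, which are
    -- non-zero exactly on `p`.
    vectorSupport-indicator : ∀ p → vectorSupport (lc (indicator p)) ≡ p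
    vectorSupport-indicator p = ⊆-antisym
      (λ {i} i∈ → indicator≉0⇒∈ λ pi≈0 → ∈-comprehension⁻ (nonzero? v) i∈ (F.trans (at i) pi≈0))
      (λ {i} i∈p → ∈-comprehension⁺ (nonzero? v) λ vi≈0 →
        ∈⇒indicator≉0 i∈p (F.trans (F.sym (at i)) vi≈0))
      where
      v = lc (indicator p)
      at : ∀ i → coordinate v i F.≈ indicator p i
      at = coordinate-unique (indicator p) V.≈ᴹ-refl

    nonZeroComponentGraph-isIntersectionGraph :
      IsIntersectionGraph (nonZeroComponentGraph F V b) n
    nonZeroComponentGraph-isIntersectionGraph = record
      { support = record
        { to        = vectorSupport ∘ proj₁
        ; cong      = λ u≈v → ⊆-antisym (vectorSupport-⊆ u≈v) (vectorSupport-⊆ (V.≈ᴹ-sym u≈v))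
        ; injective = vectorSupport-injective
        }
      ; supp-nonempty   = vectorSupport-nonempty ∘ proj₂
      -- Independence makes the combination a vertex: were it zero, its coefficient at `i` would
      -- vanish.
      ; supp-surjective = λ p (i , i∈p) →
          (lc (indicator p) , λ p≈0 → ∈⇒indicator≉0 i∈p (independent (indicator p) p≈0 i))
        , vectorSupport-indicator p
      ; adjacent⇒meet   = λ (_ , i , i∈u , i∈w) → i , ∈-vectorSupport⁺ i∈u , ∈-vectorSupport⁺ i∈w
      ; meet⇒adjacent   = λ u≉w i∈u i∈w → u≉w , _ , ∈-vectorSupport⁻ i∈u , ∈-vectorSupport⁻ i∈w
      }

lemma2p12 : ∀ {c ℓ m ℓm} (F : Field c ℓ) (V : VectorSpace F m ℓm) (q n : ℕ) →
    HasCardinality (Field.setoid F) q → (b : Basis F V n) →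
    q ≡ 2 → n > 3 →
    ¬ LocatingDomination.ExchangeProperty (nonZeroComponentGraph F V b)
lemma2p12 F V q n F-card b refl n>3 =
  ¬exchangeProperty (nonZeroComponentGraph-isIntersectionGraph F V b F-card) n>3
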